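{- Let $G$ and $H$ be finite abelian groups, written additively, of the same even order $k$, and let $f:G\to H$ be semi-planar. If $S(G,H;f)$ splits into two substructures, then each of the two substructures is divisible.
   Context: A function $f:G\to H$ is semi-planar if for every non-identity $a\in G$ and every $y\in H$, the equation $f(x+a)-f(x)=y$ has either $0$ or $2$ solutions $x\in G$. The incidence structure $S(G,H;f)$ has points $(x,y)\in G\times H$ and lines $\mathcal{L}(a,b)$ for $(a,b)\in G\times H$, with $(x,y)$ incident with $\mathcal{L}(a,b)$ iff $y=f(x-a)+b$. Its incidence graph is the bipartite graph on points and lines with an edge for each incident point-line pair. $S(G,H;f)$ splits into two substructures if its incidence graph has exactly two connected components; the substructures are the incidence structures formed by the points and lines of each component (each consists of $k^2/2$ points and $k^2/2$ lines). An incidence structure is divisible if its points can be partitioned into classes such that two distinct points from the same class lie on no common line and two points from different classes lie on exactly two common lines. -}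

module Defs where

open import Algebra.Bundles using (AbelianGroup)
open import Data.Fin.Base using (Fin)
open import Data.Nat.Base using (ℕ)
open import Data.Product.Base using (Σ; ∃; _×_; _,_; proj₁; proj₂)
open import Data.Product.Relation.Binary.Pointwise.NonDependent using (_×ₛ_)
open import Data.Sum.Base using (_⊎_; inj₁; inj₂)
open import Data.Sum.Relation.Binary.Pointwise using (_⊎ₛ_)
open import Function.Bundles using (Func; Inverse)
open import Level using (Level; _⊔_; suc)
open import Relation.Binary.Bundles using (Setoid)
open import Relation.Binary.Core using (Rel; _⇒_)
open import Relation.Binary.Structures using (IsDecEquivalence)
import Relation.Binary.Construct.Closure.Equivalence as EqClosure
import Relation.Binary.Construct.On as On
open import Relation.Binary.Construct.Union using (_∪_)
open import Relation.Binary.PropositionalEquality.Properties as ≡ using ()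
open import Relation.Nullary.Negation.Core using (¬_)

private
  variable
    c ℓ p c₁ ℓ₁ c₂ ℓ₂ i : Level

HasCardinality : Setoid c ℓ → ℕ → Set (c ⊔ ℓ)
HasCardinality S n = Inverse S (≡.setoid (Fin n))

-- Witnesses of P are irrelevant: elements are compared in S only.
subsetoid : (S : Setoid c ℓ) → (Setoid.Carrier S → Set p) → Setoid (c ⊔ p) ℓ
subsetoid S P = On.setoid {B = ∃ P} S proj₁

record IncidenceStructure (c₁ ℓ₁ c₂ ℓ₂ i : Level)
       : Set (suc (c₁ ⊔ ℓ₁ ⊔ c₂ ⊔ ℓ₂ ⊔ i)) where
  infix 4 _I_
  field
    points : Setoid c₁ ℓ₁
    lines  : Setoid c₂ ℓ₂

  module P = Setoid points
  module L = Setoid lines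

  Point : Set c₁
  Point = P.Carrier

  Line : Set c₂
  Line = L.Carrier

  field
    _I_    : Point → Line → Set i
    I-resp : ∀ {x x′ l l′} → x P.≈ x′ → l L.≈ l′ → x I l → x′ I l′

  vertices : Setoid (c₁ ⊔ c₂) (c₁ ⊔ c₂ ⊔ ℓ₁ ⊔ ℓ₂)
  vertices = points ⊎ₛ lines

  Vertex : Set (c₁ ⊔ c₂)
  Vertex = Setoid.Carrier vertices

  -- One orientation of each edge suffices, since connectedness is defined
  -- by the symmetric closure.
  data Edge : Rel Vertex (c₁ ⊔ c₂ ⊔ i) where
    edge : ∀ {x l} → x I l → Edge (inj₁ x) (inj₂ l)

  -- Vertex equality is included so that equal isolated vertices are connected.
  components : Setoid (c₁ ⊔ c₂) (c₁ ⊔ c₂ ⊔ ℓ₁ ⊔ ℓ₂ ⊔ i)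
  components = EqClosure.setoid (Setoid._≈_ vertices ∪ Edge)

  Connected : Rel Vertex (c₁ ⊔ c₂ ⊔ ℓ₁ ⊔ ℓ₂ ⊔ i)
  Connected = Setoid._≈_ components

  commonLines : Point → Point → Setoid (c₂ ⊔ i) ℓ₂
  commonLines x y = subsetoid lines (λ l → x I l × y I l)

  SplitsIntoTwo : Set (c₁ ⊔ c₂ ⊔ ℓ₁ ⊔ ℓ₂ ⊔ i)
  SplitsIntoTwo = HasCardinality components 2

  -- A partition is a decidable equivalence relation: any two points are
  -- either in the same class or in different classes.
  Divisible : Set (suc ℓ₁ ⊔ c₁ ⊔ c₂ ⊔ ℓ₂ ⊔ i)
  Divisible = Σ (Rel Point ℓ₁) λ _∼_ →
      IsDecEquivalence _∼_
    × (P._≈_ ⇒ _∼_)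
    × (∀ x y → ¬ (x P.≈ y) → x ∼ y → HasCardinality (commonLines x y) 0)
    × (∀ x y → ¬ (x ∼ y) → HasCardinality (commonLines x y) 2)

-- The component containing the vertex v.
substructure : (S : IncidenceStructure c₁ ℓ₁ c₂ ℓ₂ i) → IncidenceStructure.Vertex S →
  IncidenceStructure (c₁ ⊔ c₂ ⊔ ℓ₁ ⊔ ℓ₂ ⊔ i) ℓ₁ (c₁ ⊔ c₂ ⊔ ℓ₁ ⊔ ℓ₂ ⊔ i) ℓ₂ i
substructure S v = record
  { points = subsetoid points (λ x → Connected v (inj₁ x))
  ; lines  = subsetoid lines (λ l → Connected v (inj₂ l))
  ; _I_    = λ x l → proj₁ x I proj₁ l
  ; I-resp = I-resp
  }
  where open IncidenceStructure S

module _ (G : AbelianGroup c₁ ℓ₁) (H : AbelianGroup c₂ ℓ₂) where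
  private
    module G = AbelianGroup G renaming (_∙_ to _+_; ε to 0#)
    module H = AbelianGroup H renaming (_∙_ to _+_; ε to 0#)

  SemiPlanar : Func G.setoid H.setoid → Set (c₁ ⊔ ℓ₁ ⊔ c₂ ⊔ ℓ₂)
  SemiPlanar f = ∀ a → ¬ (a G.≈ G.0#) → ∀ y →
    HasCardinality (solutions a y) 0 ⊎ HasCardinality (solutions a y) 2
    where
    open Func f
    solutions : G.Carrier → H.Carrier → Setoid (c₁ ⊔ ℓ₂) ℓ₁
    solutions a y = subsetoid G.setoid (λ x → to (x G.+ a) H.- to x H.≈ y)

  -- Both points and lines are pairs in G × H; (a , b) as a line is ℒ(a,b).
  S : Func G.setoid H.setoid →
      IncidenceStructure (c₁ ⊔ c₂) (ℓ₁ ⊔ ℓ₂) (c₁ ⊔ c₂) (ℓ₁ ⊔ ℓ₂) ℓ₂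
  S f = record
    { points = G.setoid ×ₛ H.setoid
    ; lines  = G.setoid ×ₛ H.setoid
    ; _I_    = λ (x , y) (a , b) → y H.≈ to (x G.- a) H.+ b
    ; I-resp = λ (x≈x′ , y≈y′) (a≈a′ , b≈b′) y≈ →
        H.trans (H.sym y≈y′) (H.trans y≈
          (H.∙-cong (cong (G.∙-cong x≈x′ (G.⁻¹-cong a≈a′))) b≈b′))
    }
    where open Func f

{-# OPTIONS --safe #-}

-- The classes are the fibres of the first projection.  Translations of H act
-- on S(G,H;f), and they permute its two components transitively; so some
-- translation y ↦ y + h exchanges the components.  Fix points (x , y) and
-- (x′ , y′) of one component with d = x - x′ ≠ 0.  Their common lines
-- correspond to the solutions t of Δ t := f(t + d) - f(t) = y - y′, and every
-- value z of Δ keeps (x , y′ + z) in the component of (x′ , y′).  As Δ is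
-- two-to-one onto its image, translating it by h on one of each pair of
-- preimages gives an injective, hence surjective, map G → H; thus Δ attains
-- every z for which (x , y′ + z) lies in the component, in particular y - y′.
module Submission where

open import Defs
open import Algebra.Bundles using (AbelianGroup)
import Algebra.Properties.AbelianGroup as AbelianGroupProperties
open import Data.Empty using (⊥-elim)
open import Data.Fin.Base using (Fin; zero; suc)
open import Data.Fin.Properties using (_≟_; any?; <⇒notInjective; ¬Fin0)
open import Data.Nat.Base using (ℕ)
open import Data.Nat.Properties using (n<1+n)
open import Data.Nat.Divisibility using (_∣_)
open import Data.Product.Base using (∃-syntax; _×_; _,_; proj₁; proj₂)
open import Data.Sum.Base using (_⊎_; inj₁; inj₂)
open import Data.Sum.Relation.Binary.Pointwise using (inj₁; inj₂)
open import Function.Base using (_∘_)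
open import Function.Bundles using (Func; Inverse; Injection)
import Function.Construct.Composition as Composition
open import Function.Definitions using (Injective)
open import Function.Properties.Inverse using (Inverse⇒Injection)
open import Level using (Level; Lift; lift)
open import Relation.Binary.Bundles using (Setoid)
open import Relation.Binary.PropositionalEquality.Core as ≡
  using (_≡_; refl)
open import Relation.Binary.Definitions using (Decidable)
import Relation.Binary.Construct.Closure.Equivalence as EqClosure
import Relation.Binary.Reasoning.Setoid as SetoidReasoning
open import Relation.Nullary.Decidable using (yes; no; map′)
open import Relation.Nullary.Negation using (¬_; contradiction)

private
  variable
    c ℓ p c₁ ℓ₁ c₂ ℓ₂ : Level
    k : ℕ

-- Counting on finite setoids.

Fin-injective⇒surjective : (F : Fin k → Fin k) → Injective _≡_ _≡_ F →
                           ∀ y → ∃[ i ] F i ≡ y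
Fin-injective⇒surjective {k} F F-injective y with any? (λ i → F i ≟ y)
... | yes hit = hit
-- Pigeonhole: a missed `y` can be prepended to `F`, which would inject `Fin (suc k)` into `Fin k`.
... | no miss = ⊥-elim (<⇒notInjective (n<1+n k) extended-injective)
  where
  extended : Fin (ℕ.suc k) → Fin k
  extended zero    = y
  extended (suc i) = F i

  extended-injective : Injective _≡_ _≡_ extended
  extended-injective {zero}  {zero}  _  = refl
  extended-injective {zero}  {suc j} eq = contradiction (j , ≡.sym eq) miss
  extended-injective {suc i} {zero}  eq = contradiction (i , eq) miss
  extended-injective {suc i} {suc j} eq = ≡.cong suc (F-injective eq)

empty⇒card0 : (S : Setoid c ℓ) → ¬ Setoid.Carrier S → HasCardinality S 0
empty⇒card0 S empty = record
  { to        = λ x → contradiction x empty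
  ; from      = λ ()
  ; to-cong   = λ {x} _ → contradiction x empty
  ; from-cong = λ { {()} }
  ; inverse   = (λ { {()} }) , λ {x} _ → contradiction x empty
  }

card⇒decidable : (S : Setoid c ℓ) → HasCardinality S k →
                 Decidable (Setoid._≈_ S)
card⇒decidable S |S|≡k x y =
  map′ injective cong (to x ≟ to y)
  where open Injection (Inverse⇒Injection |S|≡k)

module _ (A : Setoid c₁ ℓ₁) (B : Setoid c₂ ℓ₂)
         (|A|≡k : HasCardinality A k) (|B|≡k : HasCardinality B k) where
  private
    module A = Setoid A
    module B = Setoid B
    module IA = Inverse |A|≡k
    module IB = Inverse |B|≡k

  -- `g` need not respect `≈`: conjugated by the two enumerations it becomes an injection of `Fin k`
  -- into itself, where the pigeonhole principle applies.
  injective⇒surjective : (g : A.Carrier → B.Carrier) →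
    (∀ {s t} → g s B.≈ g t → s A.≈ t) → ∀ y → ∃[ t ] g t B.≈ y
  injective⇒surjective g g-injective y =
    let i , eq = Fin-injective⇒surjective
                   (λ i → IB.to (g (IA.from i)))
                   (from-injective ∘ g-injective ∘ to-injective)
                   (IB.to y)
    in  IA.from i , to-injective eq
    where
    to-injective : ∀ {y z} → IB.to y ≡ IB.to z → y B.≈ z
    to-injective = Injection.injective (Inverse⇒Injection |B|≡k)

    from-injective : ∀ {i j} → IA.from i A.≈ IA.from j → i ≡ j
    from-injective {i} {j} eq = ≡.trans (≡.sym (IA.strictlyInverseˡ i))
      (≡.trans (IA.to-cong eq) (IA.strictlyInverseˡ j))

  -- Maps whose fibres have 0 or 2 elements.

  module _ (φ : A.Carrier → B.Carrier) where
    fibre : B.Carrier → Setoid _ _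
    fibre y = subsetoid A (λ t → φ t B.≈ y)

    private
      Card0or2 : B.Carrier → Set _
      Card0or2 y = HasCardinality (fibre y) 0 ⊎ HasCardinality (fibre y) 2

      index : ∀ {y} → Card0or2 y → ∀ {t} → φ t B.≈ y → Fin 2
      index (inj₁ card0) {t} φt≈y = contradiction (Inverse.to card0 (t , φt≈y)) ¬Fin0
      index (inj₂ card2) {t} φt≈y = Inverse.to card2 (t , φt≈y)

      index-injective : ∀ {y} (card : Card0or2 y) {s t}
        (φs≈y : φ s B.≈ y) (φt≈y : φ t B.≈ y) →
        index card φs≈y ≡ index card φt≈y → s A.≈ t
      index-injective (inj₁ card0) φs≈y _ _ =
        contradiction (Inverse.to card0 (_ , φs≈y)) ¬Fin0
      index-injective (inj₂ card2) _ _ =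
        Injection.injective (Inverse⇒Injection card2)

    module _ (card : ∀ y → Card0or2 y)
             (σ : B.Carrier → B.Carrier)
             (σ-injective : ∀ {y z} → σ y B.≈ σ z → y B.≈ z)
             (P : B.Carrier → Set p)
             (σ-avoids-P : ∀ {y z} → P y → P z → ¬ (y B.≈ σ z))
             (φ∈P : ∀ t → P (φ t)) where
      private
        -- Equal values of φ must be indexed by the same enumeration of their
        -- fibre, but card need not respect ≈; hence the detour through Fin k.
        φ≈canonical : ∀ t → φ t B.≈ IB.from (IB.to (φ t))
        φ≈canonical t = B.sym (IB.strictlyInverseʳ (φ t))

        ix : A.Carrier → Fin 2
        ix t = index (card _) (φ≈canonical t)

        ix-injective : ∀ {s t} → φ s B.≈ φ t → ix s ≡ ix t → s A.≈ t
        ix-injective {s} {t} φs≈φt =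
          go (IB.to-cong φs≈φt) (φ≈canonical s) (φ≈canonical t)
          where
          -- With both positions variable, matching `refl` makes the two fibres one, so a single
          -- enumeration `card` supplies both indices.
          go : ∀ {m n} → m ≡ n →
               (φs≈ : φ s B.≈ IB.from m) (φt≈ : φ t B.≈ IB.from n) →
               index (card _) φs≈ ≡ index (card _) φt≈ → s A.≈ t
          go refl = index-injective (card _)

        apply : Fin 2 → B.Carrier → B.Carrier
        apply zero    y = y
        apply (suc _) y = σ y

        apply-injective : ∀ i j {y z} → P y → P z →
          apply i y B.≈ apply j z → i ≡ j × y B.≈ z
        apply-injective zero       zero       _  _  eq = refl , eq
        apply-injective zero       (suc _)    Py Pz eq =
          contradiction eq (σ-avoids-P Py Pz)
        apply-injective (suc _)    zero       Py Pz eq =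
          contradiction (B.sym eq) (σ-avoids-P Pz Py)
        apply-injective (suc zero) (suc zero) _  _  eq = refl , σ-injective eq

        doubled : A.Carrier → B.Carrier
        doubled t = apply (ix t) (φ t)

        doubled-injective : ∀ {s t} → doubled s B.≈ doubled t → s A.≈ t
        doubled-injective {s} {t} eq =
          let ix≡ , φ≈ = apply-injective (ix s) (ix t) (φ∈P s) (φ∈P t) eq
          in  ix-injective φ≈ ix≡

      -- The values of `φ` lie in `P` and their images under `σ` avoid `P`, so `doubled` is
      -- injective and, `A` and `B` having equal size, surjective. A point of `P` can only be
      -- reached by an unshifted value, which excludes an empty fibre.
      fibre-card2 : ∀ {y} → P y → HasCardinality (fibre y) 2
      fibre-card2 {y} Py with card y
      ... | inj₂ card2 = card2
      ... | inj₁ card0 =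
        let t , eq = injective⇒surjective doubled doubled-injective y
            -- Reading `y` as `apply zero y` lets `apply-injective` force `ix t ≡ zero`.
            φt≈y   = proj₂ (apply-injective (ix t) zero (φ∈P t) Py eq)
        in  contradiction (Inverse.to card0 (t , φt≈y)) ¬Fin0

-- Subtraction identities in abelian groups.

module AbelianGroupLemmas (M : AbelianGroup c ℓ) where
  open AbelianGroup M renaming (_∙_ to _+_)
  open AbelianGroupProperties M public
    using (⁻¹-anti-homo-∙; ⁻¹-anti-homo‿-; //-rightDividesˡ; //-rightDividesʳ; ∙-cancelʳ; xyx⁻¹≈y)
  open SetoidReasoning setoid

  x+[y-x]≈y : ∀ x y → x + (y - x) ≈ y
  x+[y-x]≈y x y = trans (comm x (y - x)) (//-rightDividesˡ x y)

  x+[y-z]≈y+[x-z] : ∀ x y z → x + (y - z) ≈ y + (x - z)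
  x+[y-z]≈y+[x-z] x y z = begin
    x + (y - z)  ≈⟨ assoc x y (z ⁻¹) ⟨
    (x + y) - z  ≈⟨ ∙-congʳ (comm x y) ⟩
    (y + x) - z  ≈⟨ assoc y x (z ⁻¹) ⟩
    y + (x - z)  ∎

  x-[y-z]≈z+[x-y] : ∀ x y z → x - (y - z) ≈ z + (x - y)
  x-[y-z]≈z+[x-y] x y z =
    trans (∙-congˡ (⁻¹-anti-homo‿- y z)) (x+[y-z]≈y+[x-z] x z y)

  x-[x-y]≈y : ∀ x y → x - (x - y) ≈ y
  x-[x-y]≈y x y = trans (∙-congˡ (⁻¹-anti-homo‿- x y)) (x+[y-x]≈y x y)

  [y-z]+[x-y]≈x-z : ∀ x y z → (y - z) + (x - y) ≈ x - z
  [y-z]+[x-y]≈x-z x y z = trans (sym (x-[y-z]≈z+[x-y] x y (y - z)))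
    (∙-congˡ (⁻¹-cong (x-[x-y]≈y y z)))

  [x+z]-[y+z]≈x-y : ∀ x y z → (x + z) - (y + z) ≈ x - y
  [x+z]-[y+z]≈x-y x y z = begin
    (x + z) - (y + z)        ≈⟨ ∙-congˡ (⁻¹-anti-homo-∙ y z) ⟩
    (x + z) + (z ⁻¹ - y)     ≈⟨ assoc (x + z) (z ⁻¹) (y ⁻¹) ⟨
    ((x + z) - z) - y        ≈⟨ ∙-congʳ (//-rightDividesʳ z x) ⟩
    x - y                    ∎

  x-y≈ε⇒x≈y : ∀ {x y} → x - y ≈ ε → x ≈ y
  x-y≈ε⇒x≈y {x} {y} x-y≈ε = begin
    x            ≈⟨ x+[y-x]≈y y x ⟨
    y + (x - y)  ≈⟨ ∙-congˡ x-y≈ε ⟩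
    y + ε        ≈⟨ identityʳ y ⟩
    y            ∎

-- Components of the incidence graph and translations of `H`.

module Components (G : AbelianGroup c₁ ℓ₁) (H : AbelianGroup c₂ ℓ₂)
  (f : Func (AbelianGroup.setoid G) (AbelianGroup.setoid H)) where

  module G = AbelianGroup G renaming (_∙_ to _+_; ε to 0#)
  module H = AbelianGroup H renaming (_∙_ to _+_; ε to 0#)
  module GL = AbelianGroupLemmas G
  module HL = AbelianGroupLemmas H
  open Func f using (to; cong)
  open IncidenceStructure (S G H f) public
    using (Vertex; Connected; Edge; edge; SplitsIntoTwo; Point; Line; _I_;
           vertices; components)
  module V = Setoid vertices
  module C = Setoid components

  ≈⇒Connected : ∀ {u w} → u V.≈ w → Connected u w
  ≈⇒Connected u≈w = EqClosure.return (inj₁ u≈w)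

  I⇒Connected : ∀ {x l} → x I l → Connected (inj₁ x) (inj₂ l)
  I⇒Connected xIl = EqClosure.return (inj₂ (edge xIl))

  shift : H.Carrier → Vertex → Vertex
  shift h (inj₁ (x , y)) = inj₁ (x , y H.+ h)
  shift h (inj₂ (a , b)) = inj₂ (a , b H.+ h)

  -- Adding `h` to both sides of `y ≈ to (x - a) + b` keeps it true, so edges go to edges and paths
  -- to paths.
  shift-Connected : ∀ h {u w} → Connected u w → Connected (shift h u) (shift h w)
  shift-Connected h = EqClosure.gmap (shift h) step
    where
    step : ∀ {u w} → u V.≈ w ⊎ Edge u w →
           shift h u V.≈ shift h w ⊎ Edge (shift h u) (shift h w)
    step (inj₁ (inj₁ (x≈ , y≈))) = inj₁ (inj₁ (x≈ , H.∙-congʳ y≈))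
    step (inj₁ (inj₂ (a≈ , b≈))) = inj₁ (inj₂ (a≈ , H.∙-congʳ b≈))
    step (inj₂ (edge y≈))        = inj₂ (edge (H.trans (H.∙-congʳ y≈) (H.assoc _ _ _)))

  shift-Connected⁻¹ : ∀ h {u w} → Connected (shift h u) (shift h w) → Connected u w
  shift-Connected⁻¹ h {u} {w} u+h~w+h =
    C.trans (C.sym (undo u)) (C.trans (shift-Connected (h H.⁻¹) u+h~w+h) (undo w))
    where
    undo : ∀ u → Connected (shift (h H.⁻¹) (shift h u)) u
    undo (inj₁ (x , y)) = ≈⇒Connected (inj₁ (G.refl , HL.//-rightDividesʳ h y))
    undo (inj₂ (a , b)) = ≈⇒Connected (inj₂ (G.refl , HL.//-rightDividesʳ h b))

  -- Each line has a point over every `x`, and each point lies on a line. So any two components meet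
  -- a common fibre of the first projection, where a translation takes one to the other.
  fibre-meets-component : ∀ x w → ∃[ y ] Connected w (inj₁ (x , y))
  fibre-meets-component x (inj₂ (a , b)) =
    to (x G.- a) H.+ b , C.sym (I⇒Connected H.refl)
  fibre-meets-component x (inj₁ (x′ , y′)) =
    -- Any first coordinate gives a line through the point; `x′` is chosen and the second coordinate
    -- solved for.
    let y , l~xy = fibre-meets-component x (inj₂ (x′ , y′ H.- to (x′ G.- x′)))
    in  y , C.trans (I⇒Connected (H.sym (HL.x+[y-x]≈y _ y′))) l~xy

  module _ (splits : SplitsIntoTwo) where
    private
      module I = Inverse splits

      in-first-or-second : ∀ u → Connected u (I.from zero) ⊎ Connected u (I.from (suc zero))
      in-first-or-second u = go (I.to u) (C.sym (I.strictlyInverseʳ u))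
        where
        go : ∀ i → Connected u (I.from i) →
             Connected u (I.from zero) ⊎ Connected u (I.from (suc zero))
        go zero       = inj₁
        go (suc zero) = inj₂

      first-second-disconnected : ¬ Connected (I.from zero) (I.from (suc zero))
      first-second-disconnected c
        with () ← ≡.trans (≡.sym (I.strictlyInverseˡ zero))
                    (≡.trans (I.to-cong c) (I.strictlyInverseˡ (suc zero)))

    -- `h` is the difference of two points over `0#`, one in each component, so it carries the first
    -- component to the second. As translations permute just two components, it cannot fix the
    -- second.
    swapping-shift : ∃[ h ] ∀ u → ¬ Connected u (shift h u)
    swapping-shift = h , no-fixed-component
      where
      y₀ y₁ h : H.Carrier
      y₀ = proj₁ (fibre-meets-component G.0# (I.from zero))
      y₁ = proj₁ (fibre-meets-component G.0# (I.from (suc zero)))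
      h  = y₁ H.- y₀

      q : Vertex
      q = inj₁ (G.0# , y₀)

      first~q : Connected (I.from zero) q
      first~q = proj₂ (fibre-meets-component G.0# (I.from zero))

      second~q+h : Connected (I.from (suc zero)) (shift h q)
      second~q+h = C.trans (proj₂ (fibre-meets-component G.0# (I.from (suc zero))))
        (≈⇒Connected (inj₁ (G.refl , H.sym (HL.x+[y-x]≈y y₀ y₁))))

      q≁q+h : ¬ Connected q (shift h q)
      q≁q+h q~q+h = first-second-disconnected
        (C.trans first~q (C.trans q~q+h (C.sym second~q+h)))

      transport : ∀ {u w} → Connected u w → Connected u (shift h u) → Connected w (shift h w)
      transport u~w u~u+h = C.trans (C.sym u~w) (C.trans u~u+h (shift-Connected h u~w))

      no-fixed-component : ∀ u → ¬ Connected u (shift h u)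
      no-fixed-component u u~u+h with in-first-or-second u
      ... | inj₁ u~first  = q≁q+h (transport (C.trans u~first first~q) u~u+h)
      -- Transport connects `q + h` to `(q + h) + h`; undoing one translation connects `q` to
      -- `q + h`.
      ... | inj₂ u~second = q≁q+h (shift-Connected⁻¹ h
                              (transport (C.trans u~second second~q+h) u~u+h))

  -- Common lines as solutions of a difference equation.

  same-fibre⇒≈ : ∀ {x x′ y y′} {l : Line} → x G.≈ x′ →
                 (x , y) I l → (x′ , y′) I l → y H.≈ y′
  same-fibre⇒≈ x≈x′ y≈ y′≈ =
    H.trans y≈ (H.trans (H.∙-congʳ (cong (G.∙-congʳ x≈x′))) (H.sym y′≈))

  Δ : G.Carrier → G.Carrier → H.Carrier
  Δ d t = to (t G.+ d) H.- to t

  solutions : G.Carrier → H.Carrier → Setoid _ _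
  solutions d z = subsetoid G.setoid (λ t → Δ d t H.≈ z)

  -- The line through (x′ , y′) that joins it to (x , y′ + Δ (x - x′) t).
  joining : Point → G.Carrier → Line
  joining (x′ , y′) t = x′ G.- t , y′ H.- to t

  I-joining : ∀ p t → p I joining p t
  I-joining (x′ , y′) t = H.sym (H.trans
    (H.∙-congʳ (cong (GL.x-[x-y]≈y x′ t)))
    (HL.x+[y-x]≈y (to t) y′))

  I-joining-Δ : ∀ x x′ y′ t →
    (x , y′ H.+ Δ (x G.- x′) t) I joining (x′ , y′) t
  I-joining-Δ x x′ y′ t = H.sym (H.trans
    (H.∙-congʳ (cong (GL.x-[y-z]≈z+[x-y] x x′ t)))
    (HL.x+[y-z]≈y+[x-z] _ y′ (to t)))

  -- Subtracting the two incidence equations cancels `b`; with `t = x′ - a`, the argument `x - a` is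
  -- `t + (x - x′)`.
  I⇒Δ : ∀ {x y x′ y′ a b} → (x , y) I (a , b) → (x′ , y′) I (a , b) →
        Δ (x G.- x′) (x′ G.- a) H.≈ y H.- y′
  I⇒Δ {x} {y} {x′} {y′} {a} {b} y≈ y′≈ = begin
    Δ (x G.- x′) (x′ G.- a)                           ≈⟨ H.∙-congʳ (cong (GL.[y-z]+[x-y]≈x-z x x′ a)) ⟩
    to (x G.- a) H.- to (x′ G.- a)                    ≈⟨ HL.[x+z]-[y+z]≈x-y _ _ b ⟨
    (to (x G.- a) H.+ b) H.- (to (x′ G.- a) H.+ b)    ≈⟨ H.∙-cong y≈ (H.⁻¹-cong y′≈) ⟨
    y H.- y′                                          ∎
    where open SetoidReasoning H.setoid

  module _ (v : Vertex) where
    private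
      module Sub = IncidenceStructure (substructure (S G H f) v)

    commonLines-empty : (p q : Sub.Point) → ¬ (p Sub.P.≈ q) →
      proj₁ (proj₁ p) G.≈ proj₁ (proj₁ q) → HasCardinality (Sub.commonLines p q) 0
    commonLines-empty p q p≉q x≈x′ = empty⇒card0 (Sub.commonLines p q)
      λ { ((l , _) , pIl , qIl) → p≉q (x≈x′ , same-fibre⇒≈ {l = l} x≈x′ pIl qIl) }

    -- A line `(a , b)` through `q` is determined by `a`, since incidence forces `b`; so
    -- `t = x′ - a` is a faithful coordinate on the common lines.
    commonLines↔solutions : (p q : Sub.Point) →
      let (x , y) , _ = p ; (x′ , y′) , _ = q in
      Inverse (Sub.commonLines p q) (solutions (x G.- x′) (y H.- y′))
    commonLines↔solutions p@((x , y) , _) q@((x′ , y′) , v~q) = record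
      { to        = λ { (((a , b) , _) , pIl , qIl) → x′ G.- a , I⇒Δ pIl qIl }
      ; from      = λ { (t , Δt≈) →
          -- Passing through `q` puts the joining line in the component of `v`, so the substructure
          -- loses no common line.
          (joining (x′ , y′) t , C.trans v~q (I⇒Connected (I-joining (x′ , y′) t)))
          , H.trans (H.sym (H.trans (H.∙-congˡ Δt≈) (HL.x+[y-x]≈y y′ y)))
                    (I-joining-Δ x x′ y′ t)
          , I-joining (x′ , y′) t }
      ; to-cong   = λ (a≈ , _) → G.∙-congˡ (G.⁻¹-cong a≈)
      ; from-cong = λ t≈u → G.∙-congˡ (G.⁻¹-cong t≈u) , H.∙-congˡ (H.⁻¹-cong (cong t≈u))
      ; inverse   =
          (λ {t} (a≈ , _) →
            G.trans (G.∙-congˡ (G.⁻¹-cong a≈)) (GL.x-[x-y]≈y x′ (proj₁ t)))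
        , λ { {((a , b) , _) , _ , qIl} t≈ →
              G.trans (G.∙-congˡ (G.⁻¹-cong t≈)) (GL.x-[x-y]≈y x′ a)
            , H.trans (H.∙-cong qIl (H.⁻¹-cong (cong t≈)))
                (HL.xyx⁻¹≈y _ b) }
      }

    commonLines-card2 : HasCardinality G.setoid k → HasCardinality H.setoid k →
      SemiPlanar G H f → SplitsIntoTwo →
      (p q : Sub.Point) → ¬ (proj₁ (proj₁ p) G.≈ proj₁ (proj₁ q)) →
      HasCardinality (Sub.commonLines p q) 2
    commonLines-card2 |G|≡k |H|≡k semiPlanar splits
      p@((x , y) , v~p) q@((x′ , y′) , v~q) x≉x′ =
      Composition.inverse (commonLines↔solutions p q)
        (fibre-card2 G.setoid H.setoid |G|≡k |H|≡k (Δ d)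
          (semiPlanar d (x≉x′ ∘ GL.x-y≈ε⇒x≈y))
          (H._+ h) (HL.∙-cancelʳ h _ _)
          SameComponent h-leaves Δ-stays y-y′-stays)
      where
      d : G.Carrier
      d = x G.- x′

      h : H.Carrier
      h = proj₁ (swapping-shift splits)

      SameComponent : H.Carrier → Set _
      SameComponent z = Connected (inj₁ (x′ , y′)) (inj₁ (x , y′ H.+ z))

      -- If `z ≈ w + h`, the points over `x` given by `z` and `w` differ by the swapping
      -- translation, so they cannot share a component.
      h-leaves : ∀ {z w} → SameComponent z → SameComponent w → ¬ (z H.≈ w H.+ h)
      h-leaves {z} {w} q~z q~w z≈w+h = proj₂ (swapping-shift splits) (inj₁ (x , y′ H.+ w))
        (C.trans (C.sym q~w) (C.trans q~z (≈⇒Connected (inj₁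
          (G.refl , H.trans (H.∙-congˡ z≈w+h) (H.sym (H.assoc y′ w h)))))))

      -- Both points lie on the line `joining (x′ , y′) t`.
      Δ-stays : ∀ t → SameComponent (Δ d t)
      Δ-stays t = C.trans (I⇒Connected (I-joining (x′ , y′) t))
        (C.sym (I⇒Connected (I-joining-Δ x x′ y′ t)))

      -- Since `y′ + (y - y′)` is `y`, this expresses that `p` and `q` both lie in the component of
      -- `v`.
      y-y′-stays : SameComponent (y H.- y′)
      y-y′-stays = C.trans (C.sym v~q) (C.trans v~p
        (≈⇒Connected (inj₁ (G.refl , H.sym (HL.x+[y-x]≈y y′ y)))))

theorem1 : {c₁ ℓ₁ c₂ ℓ₂ : Level}
    (G : AbelianGroup c₁ ℓ₁) (H : AbelianGroup c₂ ℓ₂) (k : ℕ) →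
    HasCardinality (AbelianGroup.setoid G) k →
    HasCardinality (AbelianGroup.setoid H) k →
    2 ∣ k →
    (f : Func (AbelianGroup.setoid G) (AbelianGroup.setoid H)) →
    SemiPlanar G H f →
    IncidenceStructure.SplitsIntoTwo (S G H f) →
    (v : IncidenceStructure.Vertex (S G H f)) →
    IncidenceStructure.Divisible (substructure (S G H f) v)
theorem1 {ℓ₂ = ℓ₂} G H k |G|≡k |H|≡k _ f semiPlanar splits v =
    -- `Lift` raises equality in `G` to the level of equality of points, as `Divisible` requires of
    -- the class relation.
    (λ p q → Lift ℓ₂ (proj₁ (proj₁ p) G.≈ proj₁ (proj₁ q)))
  , record
    { isEquivalence = record
      { refl  = lift G.refl
      ; sym   = λ (lift x≈y) → lift (G.sym x≈y)
      ; trans = λ (lift x≈y) (lift y≈z) → lift (G.trans x≈y y≈z)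
      }
    ; _≟_ = λ p q → map′ lift Lift.lower
        (card⇒decidable G.setoid |G|≡k (proj₁ (proj₁ p)) (proj₁ (proj₁ q)))
    }
  , (λ (x≈x′ , _) → lift x≈x′)
  , (λ p q p≉q (lift x≈x′) → commonLines-empty v p q p≉q x≈x′)
  , (λ p q p≁q → commonLines-card2 v |G|≡k |H|≡k semiPlanar splits p q (p≁q ∘ lift))
  where open Components G H f
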